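{- The function $(1^n)\mapsto\#\mathrm{Par}(n)$ is in $\#\mathsf{L}$.
   Context: $\mathrm{Par}(n)$ is the set of integer partitions of $n$. The alphabet is $\Sigma=\{0,1\}$; $1^n$ is the string of $n$ ones. A function given only on strings of a displayed form is extended by $0$ to all other strings. $\#\mathsf{L}$ is the class of functions $f:\Sigma^*\to\mathbb{N}_0$ such that $f(x)$ is the number of accepting computation paths on input $x$ of a fixed nondeterministic Turing machine with read-only input tape that uses $O(\log|x|)$ work space and halts on every computation path. Equivalently: there are a polynomial $q$ and a deterministic $O(\log|x|)$-space Turing machine $M$ with an additional read-once, left-to-right witness tape such that $f(x)=\#\{w\in\Sigma^{q(|x|)}\mid M(x,w)=\mathsf{yes}\}$. -}

module Defs where

open import Data.Bool using (Bool; true; T; if_then_else_)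
import Data.Bool.Properties as Bool
open import Data.Empty using (⊥)
open import Data.Fin using (Fin; zero; suc)
open import Data.List using (List; []; _∷_; length; replicate; filter; lookup; upTo; cartesianProductWith)
open import Data.List.Membership.Propositional using (_∈_)
open import Data.List.Membership.Propositional.Properties
  using (∈-cartesianProductWith⁺; ∈-cartesianProductWith⁻; ∈-upTo⁺; ∈-filter⁺; ∈-filter⁻; ∈-lookup)
import Data.List.Properties as List
open import Data.List.Relation.Unary.All as All using (All; []; _∷_)
open import Data.List.Relation.Unary.AllPairs using ([]; _∷_)
open import Data.List.Relation.Unary.Any using (here; there; index)
open import Data.List.Relation.Unary.Any.Properties using (lookup-index)
open import Data.List.Relation.Unary.Linked as Linked using (Linked)
open import Data.List.Relation.Unary.Unique.Propositional using (Unique)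
open import Data.List.Relation.Unary.Unique.Propositional.Properties
  using (cartesianProductWith⁺; upTo⁺; filter⁺)
open import Data.Nat using (ℕ; zero; suc; _+_; _*_; _≤_; _≥_; _<_; z≤n; s≤s; _≟_; _<?_; _≥?_)
open import Data.Nat.ListAction using (sum)
open import Data.Nat.Logarithm using (⌊log₂_⌋)
import Data.Nat.Properties as ℕ
open import Data.Product using (Σ-syntax; ∃-syntax; _×_; _,_; proj₁; proj₂)
open import Data.Vec as Vec using (Vec)
open import Function using (_↔_; mk↔ₛ′; flip)
open import Induction.WellFounded using (Acc)
open import Relation.Binary.Construct.Closure.ReflexiveTransitive using (Star)
open import Relation.Binary.PropositionalEquality using (_≡_; refl; sym; cong; cong₂)
open import Relation.Nullary using (Dec; does; _×-dec_; contradiction)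

HasSize : Set → ℕ → Set
HasSize A n = Fin n ↔ A

-- The alphabet {0,1}, with true as the letter 1.
String : Set
String = List Bool

1^_ : ℕ → String
1^ n = replicate n true

_≟ˢ_ : (x y : String) → Dec (x ≡ y)
_≟ˢ_ = List.≡-dec Bool._≟_

-- (1ⁿ) ↦ g n, extended by 0 to all strings that are not of the form 1ⁿ.
onUnary : (ℕ → ℕ) → String → ℕ
onUnary g x = if does (x ≟ˢ (1^ length x)) then g (length x) else 0

data Move : Set where
  left stay right : Move

-- A two-way infinite tape on which only the cells visited so far (and hence
-- possibly non-blank) are stored: those to the left of the head, nearest first,
-- the scanned one, and those to the right, nearest first.
record Tape (Γ : Set) : Set where
  constructor tape
  field
    before : List Γ
    scan   : Γ
    after  : List Γ

  visited : ℕ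
  visited = length before + suc (length after)

module _ {Γ : Set} where

  moveTape : (blank : Γ) → Move → Tape Γ → Tape Γ
  moveTape _ stay  t                   = t
  moveTape b left  (tape []       s r) = tape [] b (s ∷ r)
  moveTape _ left  (tape (a ∷ l)  s r) = tape l a (s ∷ r)
  moveTape b right (tape l s []      ) = tape (s ∷ l) b []
  moveTape _ right (tape l s (a ∷ r) ) = tape (s ∷ l) a r

  updateTape : (blank : Γ) → Γ × Move → Tape Γ → Tape Γ
  updateTape b (w , m) t = moveTape b m record t { scan = w }

-- The input x is written as ⊢x⊣; position 0 holds ⊢.
data InputSymbol : Set where
  ⊢ ⊣ : InputSymbol
  bit : Bool → InputSymbol

inputAt : String → ℕ → InputSymbol
inputAt _       zero          = ⊢
inputAt []      (suc _)       = ⊣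
inputAt (b ∷ _) (suc zero)    = bit b
inputAt (_ ∷ x) (suc (suc i)) = inputAt x (suc i)

-- The input head cannot leave ⊢x⊣: moving left from ⊢ or right from ⊣ has no effect.
moveInput : Move → InputSymbol → ℕ → ℕ
moveInput stay  _       i       = i
moveInput left  _       zero    = zero
moveInput left  _       (suc i) = i
moveInput right ⊣       i       = i
moveInput right ⊢       i       = suc i
moveInput right (bit _) i       = suc i

data Status : Set where
  running accepting rejecting : Status

record Action (Q Γ : Set) (k : ℕ) : Set where
  constructor action
  field
    next      : Q
    inputMove : Move
    work      : Vec (Γ × Move) k   -- symbol to write and head move, per work tape

record Configuration (Q Γ : Set) (k : ℕ) : Set where
  constructor config
  field
    state : Q
    inPos : ℕ
    tapes : Vec (Tape Γ) k

open Configuration public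

record NTM : Set₁ where
  field
    Q Γ      : Set
    #Q #Γ #W : ℕ              -- #W is the number of work tapes
    Q-finite : HasSize Q #Q
    Γ-finite : HasSize Γ #Γ
    start    : Q
    status   : Q → Status
    blank    : Γ
    -- The transition relation, given by its characteristic function.
    δ        : Q → InputSymbol → Vec Γ #W → Action Q Γ #W → Bool

  Config : Set
  Config = Configuration Q Γ #W

  initial : Config
  initial = config start 0 (Vec.replicate #W (tape [] blank []))

  apply : String → Action Q Γ #W → Config → Config
  apply x (action q m ws) (config _ i ts) =
    config q (moveInput m (inputAt x i) i) (Vec.zipWith (updateTape blank) ws ts)

  -- Steps remember the action taken, so that two runs are equal exactly when
  -- they make the same nondeterministic choices.  A configuration has no
  -- successor if its state is not running or if δ offers no action.
  data Step (x : String) (c : Config) : Config → Set where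
    step : (a : Action Q Γ #W) →
           status (state c) ≡ running →
           T (δ (state c) (inputAt x (inPos c)) (Vec.map Tape.scan (tapes c)) a) →
           Step x c (apply x a c)

  Run : String → Config → Config → Set
  Run x = Star (Step x)

  AcceptingPath : String → Set
  AcceptingPath x = Σ[ c ∈ Config ] (Run x initial c × status (state c) ≡ accepting)

  -- Every run is finite, as accessibility of the initial configuration.
  HaltsOnEveryPath : String → Set
  HaltsOnEveryPath x = Acc (flip (Step x)) initial

  space : Config → ℕ
  space c = Vec.sum (Vec.map Tape.visited (tapes c))

  UsesSpaceAtMost : String → ℕ → Set
  UsesSpaceAtMost x s = ∀ c → Run x initial c → space c ≤ s

-- The summand 1 keeps the bound meaningful for |x| ≤ 1, where ⌊log₂ |x| ⌋ is 0.
UsesLogSpace : NTM → Set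
UsesLogSpace M =
  ∃[ k ] (∀ x → NTM.UsesSpaceAtMost M x (k * (1 + ⌊log₂ (length x) ⌋)))

#L : (String → ℕ) → Set₁
#L f = Σ[ M ∈ NTM ]
  ( UsesLogSpace M
  × (∀ x → NTM.HaltsOnEveryPath M x)
  × (∀ x → HasSize (NTM.AcceptingPath M x) (f x)))

IsPartition : ℕ → List ℕ → Set
IsPartition n λs = All (0 <_) λs × Linked _≥_ λs × sum λs ≡ n

Par : ℕ → Set
Par n = Σ[ λs ∈ List ℕ ] IsPartition n λs

-- Par n is finite: its elements are lists of length ≤ n with entries ≤ n.
private
  isPartition? : ∀ n λs → Dec (IsPartition n λs)
  isPartition? n λs = All.all? (0 <?_) λs ×-dec Linked.linked? _≥?_ λs ×-dec (sum λs ≟ n)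

  isPartition-irrelevant : ∀ {n λs} (p q : IsPartition n λs) → p ≡ q
  isPartition-irrelevant (a , b , c) (a′ , b′ , c′) =
    cong₂ _,_ (All.irrelevant ℕ.≤-irrelevant a a′)
      (cong₂ _,_ (Linked.irrelevant ℕ.≤-irrelevant b b′) (ℕ.≡-irrelevant c c′))

  candidates : ℕ → ℕ → List (List ℕ)
  candidates n zero    = [] ∷ []
  candidates n (suc k) = [] ∷ cartesianProductWith _∷_ (upTo (suc n)) (candidates n k)

  candidates-unique : ∀ n k → Unique (candidates n k)
  candidates-unique n zero    = [] ∷ []
  candidates-unique n (suc k) =
    All.tabulate nonempty
    ∷ cartesianProductWith⁺ _∷_ List.∷-injective (upTo⁺ (suc n)) (candidates-unique n k)
    where
    nonempty : ∀ {xs} → xs ∈ cartesianProductWith _∷_ (upTo (suc n)) (candidates n k) →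
               [] ≡ xs → ⊥
    nonempty xs∈ refl with ∈-cartesianProductWith⁻ _∷_ (upTo (suc n)) (candidates n k) xs∈
    ... | _ , _ , _ , _ , ()

  candidates-complete : ∀ n k λs → All (0 <_) λs → sum λs ≤ n → sum λs ≤ k → λs ∈ candidates n k
  candidates-complete n zero    []       _        _  _  = here refl
  candidates-complete n (suc k) []       _        _  _  = here refl
  candidates-complete n zero    (zero ∷ _) (() ∷ _) _ _
  candidates-complete n (suc k) (zero ∷ _) (() ∷ _) _ _
  candidates-complete n (suc k) (suc m ∷ λs) (_ ∷ ps) ≤n (s≤s ≤k) =
    there (∈-cartesianProductWith⁺ _∷_ (∈-upTo⁺ (s≤s (ℕ.m+n≤o⇒m≤o (suc m) ≤n)))
      (candidates-complete n k λs ps (ℕ.m+n≤o⇒n≤o (suc m) ≤n) (ℕ.m+n≤o⇒n≤o m ≤k)))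

  lookup-injective : ∀ {A : Set} {xs : List A} → Unique xs →
                     ∀ i j → lookup xs i ≡ lookup xs j → i ≡ j
  lookup-injective (_   ∷ _) zero    zero    _  = refl
  lookup-injective (x∉  ∷ _) zero    (suc j) eq = contradiction eq (All.lookup x∉ (∈-lookup j))
  lookup-injective (x∉  ∷ _) (suc i) zero    eq = contradiction (sym eq) (All.lookup x∉ (∈-lookup i))
  lookup-injective (_   ∷ u) (suc i) (suc j) eq = cong suc (lookup-injective u i j eq)

  enumeration : ℕ → List (List ℕ)
  enumeration n = filter (isPartition? n) (candidates n n)

  enumeration-sound : ∀ n {λs} → λs ∈ enumeration n → IsPartition n λs
  enumeration-sound n λs∈ = proj₂ (∈-filter⁻ (isPartition? n) {xs = candidates n n} λs∈)

  enumeration-complete : ∀ n {λs} → IsPartition n λs → λs ∈ enumeration n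
  enumeration-complete n p@(pos , _ , refl) =
    ∈-filter⁺ (isPartition? n) (candidates-complete n n _ pos ℕ.≤-refl ℕ.≤-refl) p

  Par-≡ : ∀ {n} {p q : Par n} → proj₁ p ≡ proj₁ q → p ≡ q
  Par-≡ {p = λs , _} {q = _ , _} refl = cong (λs ,_) (isPartition-irrelevant _ _)

Par-finite : ∀ n → ∃[ k ] HasSize (Par n) k
Par-finite n = length (enumeration n) , mk↔ₛ′ to from to-from from-to
  where
  to : Fin (length (enumeration n)) → Par n
  to i = lookup (enumeration n) i , enumeration-sound n (∈-lookup i)

  from : Par n → Fin (length (enumeration n))
  from (_ , p) = index (enumeration-complete n p)

  to-from : ∀ p → to (from p) ≡ p
  to-from (_ , p) = Par-≡ (sym (lookup-index (enumeration-complete n p)))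

  from-to : ∀ i → from (to i) ≡ i
  from-to i = lookup-injective (filter⁺ (isPartition? n) (candidates-unique n n)) _ _
                (cong proj₁ (to-from (to i)))

#Par : ℕ → ℕ
#Par n = proj₁ (Par-finite n)

{-# OPTIONS --safe #-}
module Submission where

-- A partition of n, with its parts listed in increasing order, can be guessed
-- while the input 1ⁿ is read once from left to right, the position of the input
-- head being the number of letters already assigned to parts.  The machine
-- keeps the size k of the current part in binary.  Once a part is complete it
-- either accepts, if the input is exhausted, or makes its only nondeterministic
-- choice: to enlarge the part by one, reading one more letter, or to begin the
-- next part, which has size at least k and for which k letters are read with
-- the help of a counter that starts at k and is reset afterwards.  Any letter 0
-- blocks the machine.  Part and counter share one tape, each cell holding a
-- digit of both, so that a change of either number is one pass over the digits
-- and back.  As k never exceeds the number of letters read, the digits take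
-- logarithmic space; as every enlargement reads a letter and every new part
-- reads k ≥ 1 letters, all runs are finite.
--
-- All three properties of the machine are read off its finite tree of
-- computations: any such tree bounds the space (space-bound), makes all runs
-- halt (halts) and counts the accepting ones (count).  The tree of this machine
-- is built from the leaves upwards in start-tree, by recursion on the unread
-- input, and has paths x accepting leaves.  On 1ⁿ the recurrence for paths is
-- the one that splits increasing sequences with parts at least k according to
-- whether their first part equals k (Ascending-split), so paths counts the
-- reversals of the partitions of n (paths-unary); on other strings it vanishes
-- (paths-nonunary).

open import Defs

open import Data.Bool using (Bool; true; false; T; not; _∧_; _xor_; if_then_else_)
import Data.Bool.Properties as Bool
open import Data.Empty using (⊥)
open import Data.Fin as Fin using (Fin; zero; suc)
open import Data.Fin.Patterns using (0F; 1F; 2F; 3F; 4F; 5F; 6F; 7F)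
open import Data.Fin.Permutation using (↔⇒≡)
open import Data.Fin.Properties using (1↔⊤; 2↔Bool; +↔⊎; *↔×)
open import Data.List using (List; []; _∷_; _++_; length; map; drop; reverse; _ʳ++_)
import Data.List.Properties as List
open import Data.List.Membership.Propositional using (_∈_)
open import Data.List.Membership.Propositional.Properties.WithK using (unique⇒irrelevant)
open import Data.List.Relation.Binary.Permutation.Propositional.Properties
  using (↭-reverse; All-resp-↭)
open import Data.List.Relation.Binary.Permutation.Propositional using (↭-sym)
open import Data.List.Relation.Binary.Pointwise as Pointwise using (Pointwise; []; _∷_)
open import Data.List.Relation.Unary.All as All using (All; []; _∷_)
open import Data.List.Relation.Unary.AllPairs using ([]; _∷_)
open import Data.List.Relation.Unary.Any using (here; there)
open import Data.List.Relation.Unary.Linked as Linked using (Linked; []; [-]; _∷_)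
open import Data.List.Relation.Unary.Linked.Properties using (Linked⇒All)
open import Data.List.Relation.Unary.Unique.Propositional using (Unique)
open import Data.Maybe using (Maybe; just; nothing)
import Data.Maybe.Properties as Maybe
open import Data.Nat using (ℕ; zero; suc; _+_; _*_; _^_; _≤_; _<_; z≤n; s≤s)
open import Data.Nat.ListAction using (sum)
open import Data.Nat.ListAction.Properties using (sum-↭)
open import Data.Nat.Logarithm
  using (⌊log₂_⌋; ⌊log₂⌋-mono-≤; ⌊log₂[2*b]⌋≡1+⌊log₂b⌋; ⌊log₂[2^n]⌋≡n)
import Data.Nat.Properties as ℕ
open import Data.Product using (Σ-syntax; _×_; _,_; proj₁; proj₂)
open import Data.Product.Function.NonDependent.Propositional using (_×-↔_)
import Data.Product.Properties as Product
open import Data.Sum using (_⊎_; inj₁; inj₂)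
open import Data.Sum.Function.Propositional using (_⊎-↔_)
open import Data.Unit using (⊤)
open import Data.Vec as Vec using (Vec; []; _∷_)
import Data.Vec.Properties as Vec
open import Function using (_↔_; mk↔ₛ′; flip; _∘_; Inverse)
open import Function.Properties.Inverse using (↔-sym; ↔-trans; ↔⇒↣)
open import Induction.WellFounded using (Acc; acc)
open import Relation.Binary.Construct.Closure.ReflexiveTransitive using (ε; _◅_)
open import Relation.Binary.Definitions using (DecidableEquality)
open import Relation.Binary.PropositionalEquality
  using (_≡_; _≢_; refl; sym; trans; cong; cong₂; subst)
open import Relation.Nullary using (yes; no; ¬_; contradiction; _×-dec_)
open import Relation.Nullary.Decidable
  using (map′; via-injection; isYes; toWitness; fromWitness)

-- Computation trees

module ComputationTree (M : NTM) (x : String) (S : ℕ) where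
  open NTM M

  -- The transition relation offers the action a in configuration c.
  Enabled : Config → Action Q Γ #W → Set
  Enabled c a = T (δ (state c) (inputAt x (inPos c)) (Vec.map Tape.scan (tapes c)) a)

  -- The paths counted by AcceptingPath, but starting from an arbitrary configuration.
  AcceptingFrom : Config → Set
  AcceptingFrom c = Σ[ c′ ∈ Config ] (Run x c c′ × status (state c′) ≡ accepting)

  -- Tree c n: the tree of all computations from c on input x is finite, has n
  -- accepting leaves, and all its configurations occupy at most S cells.  A
  -- branch lists exactly the enabled actions, without repetition; with the empty
  -- list it is a leaf where the machine is stuck.
  data Tree (c : Config) : ℕ → Set where
    accept : status (state c) ≡ accepting → space c ≤ S → Tree c 1
    branch : status (state c) ≡ running → space c ≤ S →
             ∀ as → Unique as → All (Enabled c) as → (∀ {a} → Enabled c a → a ∈ as) →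
             ∀ {ns} → Pointwise (λ a n → Tree (apply x a c) n) as ns → Tree c (sum ns)

  private
    running≢accepting : ∀ {s} → s ≡ running → s ≡ accepting → ⊥
    running≢accepting refl ()

    ≡-irrelevant : ∀ {A : Set} {a b : A} (p q : a ≡ b) → p ≡ q
    ≡-irrelevant refl refl = refl

  mutual
    halts : ∀ {c n} → Tree c n → Acc (flip (Step x)) c
    halts (accept e _) =
      acc λ { (step _ r _) → contradiction e (running≢accepting r) }
    halts {c} (branch _ _ _ _ _ complete ts) =
      acc λ { (step a _ en) → halts-child {c} ts (complete {a} en) }

    halts-child : ∀ {c as ns} → Pointwise (λ a n → Tree (apply x a c) n) as ns →
                  ∀ {a} → a ∈ as → Acc (flip (Step x)) (apply x a c)
    halts-child     (t ∷ _)  (here refl) = halts t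
    halts-child {c} (_ ∷ ts) (there a∈)  = halts-child {c} ts a∈

  mutual
    space-bound : ∀ {c n} → Tree c n → ∀ c′ → Run x c c′ → space c′ ≤ S
    space-bound (accept _ s)           _ ε = s
    space-bound (accept e _)           _ (step _ r _ ◅ _) =
      contradiction e (running≢accepting r)
    space-bound (branch _ s _ _ _ _ _) _ ε = s
    space-bound {c} (branch _ _ _ _ _ complete ts) c′ (step a _ en ◅ p) =
      space-bound-child {c} ts (complete {a} en) c′ p

    space-bound-child : ∀ {c as ns} → Pointwise (λ a n → Tree (apply x a c) n) as ns →
                        ∀ {a} → a ∈ as → ∀ c′ → Run x (apply x a c) c′ → space c′ ≤ S
    space-bound-child     (t ∷ _)  (here refl) = space-bound t
    space-bound-child {c} (_ ∷ ts) (there a∈)  = space-bound-child {c} ts a∈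

  private
    -- A path from an accepting configuration is empty.
    accepting-path : ∀ {c} → status (state c) ≡ accepting → ⊤ ↔ AcceptingFrom c
    accepting-path {c} e = mk↔ₛ′ (λ _ → c , ε , e) _ unique (λ _ → refl)
      where
      unique : (p : AcceptingFrom c) → (c , ε , e) ≡ p
      unique (_ , ε , e′)             = cong (λ e → c , ε , e) (≡-irrelevant e e′)
      unique (_ , step _ r _ ◅ _ , _) = contradiction e (running≢accepting r)

    -- A path from a running configuration is an enabled action followed by a path.
    split-first : ∀ {c as} → status (state c) ≡ running →
                  Unique as → All (Enabled c) as → (∀ {a} → Enabled c a → a ∈ as) →
                  (Σ[ a ∈ Action Q Γ #W ] (a ∈ as × AcceptingFrom (apply x a c))) ↔ AcceptingFrom c
    split-first {c} {as} r unique sound complete = mk↔ₛ′ to from to-from from-to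
      where
      to : _ → AcceptingFrom c
      to (a , a∈ , c′ , p , e) = c′ , step a r (All.lookup sound a∈) ◅ p , e

      from : AcceptingFrom c → _
      from (_ , ε , e)                = contradiction e (running≢accepting r)
      from (c′ , step a _ en ◅ p , e) = a , complete {a} en , c′ , p , e

      to-from : ∀ p → to (from p) ≡ p
      to-from (_ , ε , e)                 = contradiction e (running≢accepting r)
      to-from (c′ , step a r′ en ◅ p , e) =
        cong₂ (λ r en → c′ , step a r en ◅ p , e) (≡-irrelevant r r′) (Bool.T-irrelevant _ en)

      from-to : ∀ p → from (to p) ≡ p
      from-to (a , a∈ , p) = cong (λ a∈ → a , a∈ , p) (unique⇒irrelevant unique _ a∈)

    Σ-∈-∷ : ∀ {A : Set} {P : A → Set} {a as} →
            (P a ⊎ (Σ[ b ∈ A ] (b ∈ as × P b))) ↔ (Σ[ b ∈ A ] (b ∈ a ∷ as × P b))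
    Σ-∈-∷ = mk↔ₛ′
      (λ { (inj₁ p) → _ , here refl , p ; (inj₂ (b , b∈ , p)) → b , there b∈ , p })
      (λ { (_ , here refl , p) → inj₁ p ; (b , there b∈ , p) → inj₂ (b , b∈ , p) })
      (λ { (_ , here refl , p) → refl ; (b , there b∈ , p) → refl })
      (λ { (inj₁ p) → refl ; (inj₂ (b , b∈ , p)) → refl })

  mutual
    count : ∀ {c n} → Tree c n → HasSize (AcceptingFrom c) n
    count (accept e _) = ↔-trans 1↔⊤ (accepting-path e)
    count {c} (branch r _ _ unique sound complete ts) =
      ↔-trans (count-children {c} ts) (split-first r unique sound (λ {a} → complete {a}))

    count-children : ∀ {c as ns} → Pointwise (λ a n → Tree (apply x a c) n) as ns →
                     HasSize (Σ[ a ∈ Action Q Γ #W ] (a ∈ as × AcceptingFrom (apply x a c)))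
                             (sum ns)
    count-children []           = mk↔ₛ′ (λ ()) (λ { (_ , () , _) }) (λ { (_ , () , _) }) (λ ())
    count-children {c} (t ∷ ts) = ↔-trans +↔⊎
      (↔-trans (count t ⊎-↔ count-children {c} ts) Σ-∈-∷)

-- The machine

-- A digit of the part size and a digit of the counter.  Both numbers are written
-- in binary, least significant digit first, to the right of a cell that stays
-- blank and serves as the home position of the head.
Cell : Set
Cell = Bool × Bool

-- A cell of the tape; nothing is the blank.
Symbol : Set
Symbol = Maybe Cell

-- add b runs along the digits, adding the carry b to the part size; subtract b
-- does the same with the borrow b and the counter.  return b runs back home; if
-- b is true it also resets the counter to the part size.  At home, return true
-- means that the current part is complete, return false that one more of its
-- letters is to be read.
data State : Set where
  start               : State
  add subtract return : Bool → State
  done                : State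

State-finite : HasSize State 8
State-finite = mk↔ₛ′ to from
  (λ { start → refl ; (add false) → refl ; (add true) → refl ; (subtract false) → refl
     ; (subtract true) → refl ; (return false) → refl ; (return true) → refl ; done → refl })
  (λ { 0F → refl ; 1F → refl ; 2F → refl ; 3F → refl ; 4F → refl ; 5F → refl ; 6F → refl ; 7F → refl })
  where
  to : Fin 8 → State
  to 0F = start
  to 1F = add false
  to 2F = add true
  to 3F = subtract false
  to 4F = subtract true
  to 5F = return false
  to 6F = return true
  to 7F = done

  from : State → Fin 8
  from start            = 0F
  from (add false)      = 1F
  from (add true)       = 2F
  from (subtract false) = 3F
  from (subtract true)  = 4F
  from (return false)   = 5F
  from (return true)    = 6F
  from done             = 7F

Maybe-finite : ∀ {A n} → HasSize A n → HasSize (Maybe A) (suc n)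
Maybe-finite {A} {n} A-finite = mk↔ₛ′ to from to-from from-to
  where
  to : Fin (suc n) → Maybe A
  to zero    = nothing
  to (suc i) = just (Inverse.to A-finite i)

  from : Maybe A → Fin (suc n)
  from nothing  = zero
  from (just a) = suc (Inverse.from A-finite a)

  to-from : ∀ a → to (from a) ≡ a
  to-from nothing  = refl
  to-from (just a) = cong just (Inverse.strictlyInverseˡ A-finite a)

  from-to : ∀ i → from (to i) ≡ i
  from-to zero    = refl
  from-to (suc i) = cong suc (Inverse.strictlyInverseʳ A-finite i)

Symbol-finite : HasSize Symbol 5
Symbol-finite = Maybe-finite (↔-trans *↔× (2↔Bool ×-↔ 2↔Bool))

_≟ᵃ_ : DecidableEquality (Action State Symbol 1)
action q m ws ≟ᵃ action q′ m′ ws′ =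
  map′ (λ { (refl , refl , refl) → refl }) (λ { refl → refl , refl , refl })
    ((q ≟q q′) ×-dec (m ≟m m′) ×-dec Vec.≡-dec (Product.≡-dec _≟s_ _≟m_) ws ws′)
  where
  _≟q_ : DecidableEquality State
  _≟q_ = via-injection (↔⇒↣ (↔-sym State-finite)) Fin._≟_

  _≟s_ : DecidableEquality Symbol
  _≟s_ = Maybe.≡-dec (Product.≡-dec Bool._≟_ Bool._≟_)

  _≟m_ : DecidableEquality Move
  left  ≟m left  = yes refl
  left  ≟m stay  = no λ ()
  left  ≟m right = no λ ()
  stay  ≟m left  = no λ ()
  stay  ≟m stay  = yes refl
  stay  ≟m right = no λ ()
  right ≟m left  = no λ ()
  right ≟m stay  = no λ ()
  right ≟m right = yes refl

open import Data.List.Membership.DecPropositional _≟ᵃ_ using (_∈?_)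

-- Reset the counter digit to the digit of the part size if b is true.
reset : Bool → Cell → Cell
reset b (k , c) = k , (if b then k else c)

-- The actions on offer for a state, an input symbol and a work symbol.
moves : State → InputSymbol → Symbol → List (Action State Symbol 1)
moves start        ⊢          nothing = action start right ((nothing , right) ∷ []) ∷ []
moves start        (bit true) nothing = action (add true) right ((nothing , stay) ∷ []) ∷ []
moves start        ⊣          nothing = action done stay ((nothing , stay) ∷ []) ∷ []
moves (add b) _ (just (k , c)) =
  action (add (b ∧ k)) stay ((just (k xor b , c) , right) ∷ []) ∷ []
-- A final carry becomes a new leading digit.
moves (add true) _ nothing =
  action (add false) stay ((just (true , true) , right) ∷ []) ∷ []
moves (add false) _ nothing =
  action (return true) stay ((nothing , left) ∷ []) ∷ []
moves (subtract b) _ (just (k , c)) =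
  action (subtract (b ∧ not c)) stay ((just (k , c xor b) , right) ∷ []) ∷ []
-- A final borrow shows that the counter was zero, hence the part complete.
moves (subtract b) _ nothing =
  action (return b) stay ((nothing , left) ∷ []) ∷ []
moves (return b) _ (just d) =
  action (return b) stay ((just (reset b d) , left) ∷ []) ∷ []
moves (return true) ⊣ nothing =
  action done stay ((nothing , stay) ∷ []) ∷ []
-- The nondeterministic choice: enlarge the current part or begin the next one.
moves (return true) (bit true) nothing =
  action (add true) right ((nothing , right) ∷ []) ∷
  action (subtract true) stay ((nothing , right) ∷ []) ∷ []
moves (return false) (bit true) nothing =
  action (subtract true) right ((nothing , right) ∷ []) ∷ []
moves _ _ _ = []

statusOf : State → Status
statusOf done = accepting
statusOf _    = running

machine : NTM
machine = record
  { Q = State ; Γ = Symbol ; #Q = 8 ; #Γ = 5 ; #W = 1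
  ; Q-finite = State-finite ; Γ-finite = Symbol-finite
  ; start = start ; status = statusOf ; blank = nothing
  ; δ = λ { q s (g ∷ []) a → isYes (a ∈? moves q s g) }
  }

-- Binary numbers

-- Add a carry to a number given by its binary digits.
addDigit : Bool → List Bool → List Bool
addDigit b     (k ∷ ks) = (k xor b) ∷ addDigit (b ∧ k) ks
addDigit false []       = []
addDigit true  []       = true ∷ []

-- The binary digits of a number, the least significant one first.
bits : ℕ → List Bool
bits zero    = []
bits (suc k) = addDigit true (bits k)

-- The number with the given binary digits.
value : List Bool → ℕ
value []           = 0
value (false ∷ ks) = 2 * value ks
value (true  ∷ ks) = suc (2 * value ks)

length-addDigit : ∀ b ks → length ks ≤ length (addDigit b ks)
length-addDigit b []       = z≤n
length-addDigit b (k ∷ ks) = s≤s (length-addDigit (b ∧ k) ks)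

addDigit-false : ∀ ks → addDigit false ks ≡ ks
addDigit-false []       = refl
addDigit-false (k ∷ ks) = cong₂ _∷_ (Bool.xor-identityʳ k) (addDigit-false ks)

value-suc : ∀ ks → value (addDigit true ks) ≡ suc (value ks)
value-suc []           = refl
value-suc (false ∷ ks) = cong (λ l → suc (2 * value l)) (addDigit-false ks)
value-suc (true  ∷ ks) = trans (cong (2 *_) (value-suc ks)) (ℕ.*-suc 2 (value ks))

value-bits : ∀ k → value (bits k) ≡ k
value-bits zero    = refl
value-bits (suc k) = trans (value-suc (bits k)) (cong suc (value-bits k))

-- The number has a leading digit, which is 1.
data Normal : List Bool → Set where
  one : Normal (true ∷ [])
  _∷_ : ∀ k {ks} → Normal ks → Normal (k ∷ ks)

addDigit-normal : ∀ b {ks} → Normal ks → Normal (addDigit b ks)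
addDigit-normal false one      = one
addDigit-normal true  one      = false ∷ one
addDigit-normal b     (k ∷ ks) = (k xor b) ∷ addDigit-normal (b ∧ k) ks

bits-normal : ∀ k → Normal (bits (suc k))
bits-normal zero    = one
bits-normal (suc k) = addDigit-normal true (bits-normal k)

normal-length : ∀ {ks} → Normal ks → 2 ^ length ks ≤ 2 * value ks
normal-length one                = ℕ.≤-refl
normal-length (_∷_ k {ks} normal) = ℕ.*-monoʳ-≤ 2 (ℕ.≤-trans (normal-length normal) (double≤ k))
  where
  double≤ : ∀ k → 2 * value ks ≤ value (k ∷ ks)
  double≤ false = ℕ.≤-refl
  double≤ true  = ℕ.n≤1+n _

length-bits : ∀ {k n} → k ≤ n → length (bits k) ≤ 1 + ⌊log₂ n ⌋
length-bits {zero}      _   = z≤n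
length-bits {suc k} {n} k≤n = begin
  length (bits (suc k))                     ≡⟨ ⌊log₂[2^n]⌋≡n _ ⟨
  ⌊log₂ (2 ^ length (bits (suc k))) ⌋       ≤⟨ ⌊log₂⌋-mono-≤ (normal-length (bits-normal k)) ⟩
  ⌊log₂ (2 * value (bits (suc k))) ⌋        ≡⟨ cong (λ m → ⌊log₂ (2 * m) ⌋) (value-bits (suc k)) ⟩
  ⌊log₂ (2 * suc k) ⌋                       ≡⟨ ⌊log₂[2*b]⌋≡1+⌊log₂b⌋ (suc k) ⟩
  1 + ⌊log₂ (suc k) ⌋                       ≤⟨ s≤s (⌊log₂⌋-mono-≤ k≤n) ⟩
  1 + ⌊log₂ n ⌋                             ∎
  where open ℕ.≤-Reasoning

-- The cells that show the given digits both as part size and as counter.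
full : List Bool → List Cell
full = map (λ k → k , k)

-- Subtract the borrow b from the counter, modulo 2 to the number of digits.
decrease : Bool → List Cell → List Cell
decrease b []             = []
decrease b ((k , c) ∷ ds) = (k , c xor b) ∷ decrease (b ∧ not c) ds

-- The borrow that remains after the last digit in decrease b ds.
borrow : Bool → List Cell → Bool
borrow b []             = b
borrow b ((k , c) ∷ ds) = borrow (b ∧ not c) ds

-- The digits of the part size and of the counter.
part counter : List Cell → List Bool
part    = map proj₁
counter = map proj₂

part-full : ∀ ks → part (full ks) ≡ ks
part-full []       = refl
part-full (k ∷ ks) = cong (k ∷_) (part-full ks)

counter-full : ∀ ks → counter (full ks) ≡ ks
counter-full []       = refl
counter-full (k ∷ ks) = cong (k ∷_) (counter-full ks)

length-decrease : ∀ b ds → length (decrease b ds) ≡ length ds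
length-decrease b []             = refl
length-decrease b ((_ , c) ∷ ds) = cong suc (length-decrease (b ∧ not c) ds)

part-decrease : ∀ b ds → part (decrease b ds) ≡ part ds
part-decrease b []             = refl
part-decrease b ((k , c) ∷ ds) = cong (k ∷_) (part-decrease (b ∧ not c) ds)

reset-true : ∀ ds → map (reset true) ds ≡ full (part ds)
reset-true []       = refl
reset-true (d ∷ ds) = cong (_ ∷_) (reset-true ds)

reset-false : ∀ ds → map (reset false) ds ≡ ds
reset-false []       = refl
reset-false (d ∷ ds) = cong (_ ∷_) (reset-false ds)

borrow-false : ∀ ds → borrow false ds ≡ false
borrow-false []       = refl
borrow-false (_ ∷ ds) = borrow-false ds

decrease-false : ∀ ds → decrease false ds ≡ ds
decrease-false []             = refl
decrease-false ((k , c) ∷ ds) = cong₂ (λ c ds → (k , c) ∷ ds) (Bool.xor-identityʳ c) (decrease-false ds)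

borrow-zero : ∀ ds → value (counter ds) ≡ 0 → borrow true ds ≡ true
borrow-zero []                 _  = refl
borrow-zero ((_ , false) ∷ ds) eq = borrow-zero ds (ℕ.m+n≡0⇒m≡0 _ eq)

borrow-suc : ∀ ds {c} → value (counter ds) ≡ suc c → borrow true ds ≡ false
borrow-suc ((_ , true)  ∷ ds) _ = borrow-false ds
borrow-suc ((_ , false) ∷ ds) eq with value (counter ds) in eq′
... | suc _ = borrow-suc ds eq′

decrease-suc : ∀ ds {c} → value (counter ds) ≡ suc c → value (counter (decrease true ds)) ≡ c
decrease-suc ((_ , true)  ∷ ds) refl = cong (λ ds → 2 * value (counter ds)) (decrease-false ds)
decrease-suc ((_ , false) ∷ ds) eq with value (counter ds) in eq′
... | suc v rewrite decrease-suc ds eq′ = ℕ.suc-injective (trans (sym (ℕ.*-suc 2 v)) eq)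

-- The digits ds show the part size k, with no superfluous leading digits, and
-- the counter c.
Encodes : ℕ → ℕ → List Cell → Set
Encodes k c ds = part ds ≡ bits k × value (counter ds) ≡ c

encodes-full : ∀ k → Encodes k k (full (bits k))
encodes-full k = part-full (bits k) , trans (cong value (counter-full (bits k))) (value-bits k)

encodes-decrease : ∀ k {c} ds → Encodes k (suc c) ds → Encodes k c (decrease true ds)
encodes-decrease k ds (p , eq) = trans (part-decrease true ds) p , decrease-suc ds eq

-- The number of accepting paths

-- The accepting paths on the unread input y: choose k y counts them when a part
-- of size suc k has just been completed, and continue k c y when c letters of a
-- part of size suc k are still to be read.  As suc k is positive, beginning a
-- new part reads a letter at once, which leaves k letters.
mutual
  choose : ℕ → String → ℕ
  choose k []          = 1
  choose k (false ∷ y) = 0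
  choose k (true ∷ y)  = choose (suc k) y + continue k k y

  continue : ℕ → ℕ → String → ℕ
  continue k zero    y           = choose k y
  continue k (suc c) []          = 0
  continue k (suc c) (false ∷ y) = 0
  continue k (suc c) (true ∷ y)  = continue k c y

-- The accepting paths on the whole input.
paths : String → ℕ
paths []          = 1
paths (false ∷ y) = 0
paths (true ∷ y)  = choose 0 y

-- The computation tree of the machine

-- The symbol under the input head when y is the unread input.
firstSymbol : String → InputSymbol
firstSymbol []      = ⊣
firstSymbol (b ∷ _) = bit b

inputAt-drop : ∀ i x → inputAt x (suc i) ≡ firstSymbol (drop i x)
inputAt-drop zero    []      = refl
inputAt-drop zero    (_ ∷ _) = refl
inputAt-drop (suc i) []      = refl
inputAt-drop (suc i) (_ ∷ x) = inputAt-drop i x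

drop-suc : ∀ i (x : String) {b y} → drop i x ≡ b ∷ y → drop (suc i) x ≡ y
drop-suc zero    (_ ∷ _) refl = refl
drop-suc (suc i) (_ ∷ x) eq   = drop-suc i x eq

-- A stretch of digits, as stored on one side of the head, and the blank beyond it.
row : List Cell → List Symbol
row ds = map just ds ++ nothing ∷ []

length-row : ∀ ds → length (row ds) ≡ suc (length ds)
length-row []       = refl
length-row (_ ∷ ds) = cong suc (length-row ds)

-- The tape shows the digits rs, in reverse order, followed by the digits ds.
-- The head scans the cell just after rs in ahead rs ds, and the cell just before
-- ds in behind rs ds; in behind [] ds it is at home.
ahead behind : List Cell → List Cell → Tape Symbol
ahead rs []       = tape (row rs) nothing []
ahead rs (d ∷ ds) = tape (row rs) (just d) (row ds)
behind []       ds = tape [] nothing (row ds)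
behind (r ∷ rs) ds = tape (row rs) (just r) (row ds)

move-right : ∀ rs d ds → moveTape nothing right (tape (row rs) (just d) (row ds)) ≡ ahead (d ∷ rs) ds
move-right rs d []      = refl
move-right rs d (_ ∷ _) = refl

move-left : ∀ rs d ds → moveTape nothing left (tape (row rs) (just d) (row ds)) ≡ behind rs (d ∷ ds)
move-left []      d ds = refl
move-left (_ ∷ _) d ds = refl

turn : ∀ rs → moveTape nothing left (tape (row rs) nothing []) ≡ behind rs []
turn []      = refl
turn (_ ∷ _) = refl

depart : ∀ ds → moveTape nothing right (behind [] ds) ≡ ahead [] ds
depart []      = refl
depart (_ ∷ _) = refl

visited-inside : ∀ rs d ds → Tape.visited (tape (row rs) (just d) (row ds)) ≡ 2 + (length rs + suc (length ds))
visited-inside rs d ds rewrite length-row rs | length-row ds =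
  cong suc (ℕ.+-suc (length rs) (suc (length ds)))

visited-end : ∀ rs → Tape.visited (ahead rs []) ≡ 2 + (length rs + 0)
visited-end rs rewrite length-row rs =
  cong suc (ℕ.+-suc (length rs) 0)

visited-home : ∀ ds → Tape.visited (behind [] ds) ≡ 2 + length ds
visited-home ds = cong suc (length-row ds)

module _ (x : String) (S : ℕ) where
  open ComputationTree machine x S
  open NTM machine using (space; Config)

  -- The configuration with a given state, input position and work tape.
  at : State → ℕ → Tape Symbol → Config
  at q i t = config q i (t ∷ [])

  -- The configuration after an action, in terms of the symbol under the input head.
  after : ∀ {k} → Action State Symbol k → InputSymbol → ℕ → Vec (Tape Symbol) k →
          Configuration State Symbol k
  after (action q m ws) s i ts = config q (moveInput m s i) (Vec.zipWith (updateTape nothing) ws ts)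

  branches : ∀ {q i t s as ns} → statusOf q ≡ running → inputAt x i ≡ s → Tape.visited t ≤ S →
             moves q s (Tape.scan t) ≡ as → Unique as →
             Pointwise (λ a n → Tree (after a s i (t ∷ [])) n) as ns →
             Tree (at q i t) (sum ns)
  branches {q} {i} {t} r refl v refl u ts =
    branch r (subst (_≤ S) (sym (ℕ.+-identityʳ _)) v) _ u
      (All.tabulate (fromWitness {a? = _ ∈? _})) (toWitness {a? = _ ∈? _})
      (Pointwise.map (λ { {action _ _ _} t → t }) ts)

  step₁ : ∀ {q i t s q′ m w n} → statusOf q ≡ running → inputAt x i ≡ s → Tape.visited t ≤ S →
          moves q s (Tape.scan t) ≡ action q′ m (w ∷ []) ∷ [] →
          Tree (at q′ (moveInput m s i) (updateTape nothing w t)) n →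
          Tree (at q i t) n
  step₁ {q} {i} {t} r s v eq c =
    subst (Tree (at q i t)) (ℕ.+-identityʳ _) (branches r s v eq ([] ∷ []) (c ∷ []))

  back-step : ∀ {i n} b rs d ds → 2 + (length rs + suc (length ds)) ≤ S →
              Tree (at (return b) i (behind rs (reset b d ∷ ds))) n →
              Tree (at (return b) i (behind (d ∷ rs) ds)) n
  back-step {i} {n} b rs d ds v t =
    step₁ refl refl (subst (_≤ S) (sym (visited-inside rs d ds)) v) refl
      (subst (λ τ → Tree (at (return b) i τ) n) (sym (move-left rs (reset b d) ds)) t)

  turn-step : ∀ {i n} rs → 2 + (length rs + 0) ≤ S → ∀ {q b} → statusOf q ≡ running →
              (∀ s → moves q s nothing ≡ action (return b) stay ((nothing , left) ∷ []) ∷ []) →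
              Tree (at (return b) i (behind rs [])) n → Tree (at q i (ahead rs [])) n
  turn-step {i} {n} rs v {b = b} r eq t =
    step₁ r refl (subst (_≤ S) (sym (visited-end rs)) v) (eq _)
      (subst (λ τ → Tree (at (return b) i τ) n) (sym (turn rs)) t)

  ahead-step : ∀ {i n} rs d d′ ds → 2 + (length rs + suc (length ds)) ≤ S →
               ∀ {q q′} → statusOf q ≡ running →
               (∀ s → moves q s (just d) ≡ action q′ stay ((just d′ , right) ∷ []) ∷ []) →
               Tree (at q′ i (ahead (d′ ∷ rs) ds)) n → Tree (at q i (ahead rs (d ∷ ds))) n
  ahead-step {i} {n} rs d d′ ds v {q′ = q′} r eq t =
    step₁ r refl (subst (_≤ S) (sym (visited-inside rs d ds)) v) (eq _)
      (subst (λ τ → Tree (at q′ i τ) n) (sym (move-right rs d′ ds)) t)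

  private
    shift : ∀ (rs : List Cell) {m} → 2 + (length rs + suc m) ≤ S → 2 + (suc (length rs) + m) ≤ S
    shift rs = subst (λ l → 2 + l ≤ S) (ℕ.+-suc (length rs) _)

  -- The pass over the remaining digits ds and the way back to the cell in
  -- front of them.  What happens on the way back depends only on the final borrow,
  -- which is determined by b and ds.
  subtract-trip : ∀ {i n} b rs ds → 2 + (length rs + length ds) ≤ S →
    Tree (at (return (borrow b ds)) i (behind rs (map (reset (borrow b ds)) (decrease b ds)))) n →
    Tree (at (subtract b) i (ahead rs ds)) n
  subtract-trip b rs []             v t = turn-step rs v refl (λ _ → refl) t
  subtract-trip b rs ((k , c) ∷ ds) v t =
    ahead-step rs (k , c) (k , c xor b) ds v refl (λ _ → refl)
      (subtract-trip (b ∧ not c) ((k , c xor b) ∷ rs) ds (shift rs v)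
        (back-step (borrow (b ∧ not c) ds) rs (k , c xor b) ds′
          (subst (λ l → 2 + (length rs + suc l) ≤ S) (sym length-ds′) v) t))
    where
    ds′ = map (reset (borrow (b ∧ not c) ds)) (decrease (b ∧ not c) ds)

    length-ds′ : length ds′ ≡ length ds
    length-ds′ = trans (List.length-map _ (decrease (b ∧ not c) ds)) (length-decrease (b ∧ not c) ds)

  -- The same for the part size, with the counter being reset on the way back.
  add-trip : ∀ {i n} b rs ks → 2 + (length rs + length (addDigit b ks)) ≤ S →
    Tree (at (return true) i (behind rs (full (addDigit b ks)))) n →
    Tree (at (add b) i (ahead rs (full ks))) n
  add-trip false rs [] v t = turn-step rs v refl (λ _ → refl) t
  add-trip {i} {n} true rs [] v t =
    step₁ refl refl
      (subst (_≤ S) (sym (visited-end rs)) (ℕ.≤-trans (ℕ.+-monoʳ-≤ (2 + length rs) z≤n) v)) refl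
      (add-trip false ((true , true) ∷ rs) [] (shift rs v) (back-step true rs (true , true) [] v t))
  add-trip b rs (k ∷ ks) v t =
    ahead-step rs (k , k) (k xor b , k) (full ks)
      (ℕ.≤-trans (ℕ.+-monoʳ-≤ (2 + length rs) (s≤s length-full)) v) refl (λ _ → refl)
      (add-trip (b ∧ k) ((k xor b , k) ∷ rs) ks (shift rs v)
        (back-step true rs (k xor b , k) _
          (subst (λ l → 2 + (length rs + suc l) ≤ S) (sym (List.length-map _ (addDigit (b ∧ k) ks))) v) t))
    where
    length-full : length (full ks) ≤ length (addDigit (b ∧ k) ks)
    length-full = ℕ.≤-trans (ℕ.≤-reflexive (List.length-map _ ks)) (length-addDigit (b ∧ k) ks)

  symbol-at : ∀ i {y} → drop i x ≡ y → inputAt x (suc i) ≡ firstSymbol y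
  symbol-at i eq = trans (inputAt-drop i x) (cong firstSymbol eq)

  depart-to : ∀ {q i n} ds → Tree (at q i (ahead [] ds)) n →
              Tree (at q i (moveTape nothing right (behind [] ds))) n
  depart-to {q} {i} {n} ds = subst (λ t → Tree (at q i t) n) (sym (depart ds))

  accept-step : ∀ {q i t} → statusOf q ≡ running → inputAt x i ≡ ⊣ → Tape.visited t ≤ S →
                moves q ⊣ (Tape.scan t) ≡ action done stay ((Tape.scan t , stay) ∷ []) ∷ [] →
                Tree (at q i t) 1
  accept-step {t = tape _ _ _} r s v eq =
    step₁ r s v eq (accept refl (subst (_≤ S) (sym (ℕ.+-identityʳ _)) v))

  -- A round trip in state subtract decreases a positive counter.
  countdown : ∀ {i n} k c ds → Encodes k (suc c) ds → 2 + length ds ≤ S →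
              Tree (at (return false) i (behind [] (decrease true ds))) n →
              Tree (at (subtract true) i (ahead [] ds)) n
  countdown {i} {n} k c ds (_ , eq) v t = subtract-trip true [] ds v returning
    where
    returning : Tree (at (return (borrow true ds)) i
                         (behind [] (map (reset (borrow true ds)) (decrease true ds)))) n
    returning rewrite borrow-suc ds eq | reset-false (decrease true ds) = t

  -- A round trip in state subtract resets a counter that is zero.
  reload : ∀ {i n} k ds → Encodes k 0 ds → 2 + length ds ≤ S →
           Tree (at (return true) i (behind [] (full (bits k)))) n →
           Tree (at (subtract true) i (ahead [] ds)) n
  reload {i} {n} k ds (p , eq) v t = subtract-trip true [] ds v returning
    where
    returning : Tree (at (return (borrow true ds)) i
                         (behind [] (map (reset (borrow true ds)) (decrease true ds)))) n
    returning rewrite borrow-zero ds eq | reset-true (decrease true ds) | part-decrease true ds | p = t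

  -- A part size never exceeds the number of letters read, so it suffices that
  -- numbers up to the length of the input fit into S cells.
  module _ (fits : ∀ k → k ≤ length x → 2 + length (bits k) ≤ S) where

    encodes-fits : ∀ k c ds → Encodes k c ds → k ≤ length x → 2 + length ds ≤ S
    encodes-fits k c ds (p , _) k≤ =
      subst (λ l → 2 + l ≤ S) (trans (cong length (sym p)) (List.length-map _ ds)) (fits k k≤)

    visited-fits : ∀ k c ds → Encodes k c ds → k ≤ length x → Tape.visited (behind [] ds) ≤ S
    visited-fits k c ds e k≤ = subst (_≤ S) (sym (visited-home ds)) (encodes-fits k c ds e k≤)

    continue-step : ∀ {n} k c i y ds → drop i x ≡ true ∷ y → Encodes k (suc c) ds → k ≤ length x →
                    Tree (at (subtract true) (2 + i) (ahead [] (decrease true ds))) n →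
                    Tree (at (subtract true) (1 + i) (ahead [] ds)) n
    continue-step k c i y ds eq e k≤ t =
      countdown k c ds e (encodes-fits k (suc c) ds e k≤)
        (step₁ refl (symbol-at i eq) (visited-fits k c (decrease true ds) (encodes-decrease k ds e) k≤) refl
          (depart-to (decrease true ds) t))

    continue-stuck : ∀ k c i y ds → drop i x ≡ y → (∀ y′ → y ≢ true ∷ y′) →
                     Encodes k (suc c) ds → k ≤ length x →
                     Tree (at (subtract true) (1 + i) (ahead [] ds)) 0
    continue-stuck k c i y ds eq y≢ e k≤ =
      countdown k c ds e (encodes-fits k (suc c) ds e k≤)
        (branches refl (symbol-at i eq) (visited-fits k c (decrease true ds) (encodes-decrease k ds e) k≤)
          (no-moves y y≢) [] [])
      where
      no-moves : ∀ y → (∀ y′ → y ≢ true ∷ y′) → moves (return false) (firstSymbol y) nothing ≡ []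
      no-moves []          _  = refl
      no-moves (false ∷ _) _  = refl
      no-moves (true ∷ y)  y≢ = contradiction refl (y≢ y)

    -- The input head is at position suc i, just after the first i letters.  In
    -- choose-tree these include the current part, in continue-tree the preceding
    -- one, each of size suc k; hence suc k + length y is at most length x.
    mutual
      choose-tree : ∀ k i y → drop i x ≡ y → suc k + length y ≤ length x →
                    Tree (at (return true) (suc i) (behind [] (full (bits (suc k))))) (choose k y)
      choose-tree k i [] eq k+y≤ =
        accept-step refl (symbol-at i eq)
          (visited-fits (suc k) _ _ (encodes-full (suc k)) (ℕ.m+n≤o⇒m≤o (suc k) k+y≤)) refl
      choose-tree k i (false ∷ y) eq k+y≤ =
        branches refl (symbol-at i eq)
          (visited-fits (suc k) _ _ (encodes-full (suc k)) (ℕ.m+n≤o⇒m≤o (suc k) k+y≤)) refl [] []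
      choose-tree k i (true ∷ y) eq k+y≤ =
        subst (Tree _) (cong (choose (suc k) y +_) (ℕ.+-identityʳ _))
          (branches refl (symbol-at i eq) (visited-fits (suc k) _ _ (encodes-full (suc k)) k≤) refl
            (((λ ()) ∷ []) ∷ [] ∷ []) (larger ∷ next ∷ []))
        where
        ds = full (bits (suc k))

        k≤ : suc k ≤ length x
        k≤ = ℕ.m+n≤o⇒m≤o (suc k) k+y≤

        k+y≤′ : suc (suc k) + length y ≤ length x
        k+y≤′ = subst (_≤ length x) (cong suc (ℕ.+-suc k (length y))) k+y≤

        larger : Tree (at (add true) (2 + i) (moveTape nothing right (behind [] ds))) (choose (suc k) y)
        larger = depart-to ds
          (add-trip true [] (bits (suc k)) (fits (2 + k) (ℕ.m+n≤o⇒m≤o (2 + k) k+y≤′))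
            (choose-tree (suc k) (suc i) y (drop-suc i x eq) k+y≤′))

        next : Tree (at (subtract true) (1 + i) (moveTape nothing right (behind [] ds))) (continue k k y)
        next = depart-to ds
          (continue-step (suc k) k i y ds eq (encodes-full (suc k)) k≤
            (continue-tree k k (suc i) y (decrease true ds) (drop-suc i x eq)
              (encodes-decrease (suc k) ds (encodes-full (suc k))) (ℕ.≤-trans (ℕ.n≤1+n _) k+y≤′)))

      continue-tree : ∀ k c i y ds → drop i x ≡ y → Encodes (suc k) c ds → suc k + length y ≤ length x →
                      Tree (at (subtract true) (suc i) (ahead [] ds)) (continue k c y)
      continue-tree k zero i y ds eq e k+y≤ =
        reload (suc k) ds e (encodes-fits (suc k) 0 ds e (ℕ.m+n≤o⇒m≤o (suc k) k+y≤))
          (choose-tree k i y eq k+y≤)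
      continue-tree k (suc c) i [] ds eq e k+y≤ =
        continue-stuck (suc k) c i [] ds eq (λ _ ()) e (ℕ.m+n≤o⇒m≤o (suc k) k+y≤)
      continue-tree k (suc c) i (false ∷ y) ds eq e k+y≤ =
        continue-stuck (suc k) c i (false ∷ y) ds eq (λ _ ()) e (ℕ.m+n≤o⇒m≤o (suc k) k+y≤)
      continue-tree k (suc c) i (true ∷ y) ds eq e k+y≤ =
        continue-step (suc k) c i y ds eq e (ℕ.m+n≤o⇒m≤o (suc k) k+y≤)
          (continue-tree k c (suc i) y (decrease true ds) (drop-suc i x eq) (encodes-decrease (suc k) ds e)
            (ℕ.≤-trans (ℕ.+-monoʳ-≤ (suc k) (ℕ.n≤1+n _)) k+y≤))

    start-tree : Tree (NTM.initial machine) (paths x)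
    start-tree = step₁ refl refl (ℕ.≤-trans (s≤s z≤n) (fits 0 z≤n)) refl (after-⊢ x refl)
      where
      after-⊢ : ∀ y → x ≡ y → Tree (at start 1 (ahead [] [])) (paths y)
      after-⊢ []          eq = accept-step refl (symbol-at 0 eq) (fits 0 z≤n) refl
      after-⊢ (false ∷ y) eq = branches refl (symbol-at 0 eq) (fits 0 z≤n) refl [] []
      after-⊢ (true ∷ y)  eq = step₁ refl (symbol-at 0 eq) (fits 0 z≤n) refl
        (add-trip true [] [] (fits 1 (ℕ.≤-trans (s≤s z≤n) y<x)) (choose-tree 0 1 y (drop-suc 0 x eq) y<x))
        where
        y<x : suc (length y) ≤ length x
        y<x = ℕ.≤-reflexive (cong length (sym eq))

-- Partitions in increasing order

-- The nondecreasing lists of numbers that are at least k and add up to s.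
Ascending : ℕ → ℕ → Set
Ascending k s = Σ[ λs ∈ List ℕ ] (Linked _≤_ (k ∷ λs) × sum λs ≡ s)

Ascending-≡ : ∀ {k s} {p q : Ascending k s} → proj₁ p ≡ proj₁ q → p ≡ q
Ascending-≡ {p = λs , l , eq} {q = _ , l′ , eq′} refl =
  cong₂ (λ l eq → λs , l , eq) (Linked.irrelevant ℕ.≤-irrelevant l l′) (ℕ.≡-irrelevant eq eq′)

Ascending-empty : ∀ {k s} → 0 < s → s < k → ¬ Ascending k s
Ascending-empty ()  _   ([] , _ , refl)
Ascending-empty 0<s s<k (_ ∷ _ , k≤ ∷ _ , refl) = ℕ.<⇒≱ s<k (ℕ.≤-trans k≤ (ℕ.m≤m+n _ _))

-- Only the empty list has sum 0.
Ascending-zero : ∀ k → HasSize (Ascending (suc k) 0) 1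
Ascending-zero k = ↔-trans 1↔⊤ (mk↔ₛ′ (λ _ → [] , [-] , refl) _ unique (λ _ → refl))
  where
  unique : (p : Ascending (suc k) 0) → ([] , [-] , refl) ≡ p
  unique ([] , [-] , refl) = refl
  unique (zero ∷ _ , () ∷ _ , _)

-- Either all entries exceed suc k, or the first entry is suc k and can be removed.
Ascending-split : ∀ k t → (Ascending (suc (suc k)) (suc k + t) ⊎ Ascending (suc k) t) ↔
                          Ascending (suc k) (suc k + t)
Ascending-split k t = mk↔ₛ′ to from to-from from-to
  where
  weaken : ∀ {k λs} → Linked _≤_ (suc k ∷ λs) → Linked _≤_ (k ∷ λs)
  weaken [-]      = [-]
  weaken (k≤ ∷ l) = ℕ.≤-trans (ℕ.n≤1+n _) k≤ ∷ l

  to : _ → Ascending (suc k) (suc k + t)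
  to (inj₁ (λs , l , eq)) = λs , weaken l , eq
  to (inj₂ (λs , l , eq)) = suc k ∷ λs , ℕ.≤-refl ∷ l , cong (suc k +_) eq

  -- Abstracting over the comparison keeps its definition out of the inverse laws.
  branch-on : ∀ {a λs} → suc k < a ⊎ suc k ≡ a → Linked _≤_ (a ∷ λs) → sum (a ∷ λs) ≡ suc k + t →
              Ascending (suc (suc k)) (suc k + t) ⊎ Ascending (suc k) t
  branch-on {a} {λs} (inj₁ k<a)  l eq = inj₁ (a ∷ λs , k<a ∷ l , eq)
  branch-on {a} {λs} (inj₂ refl) l eq = inj₂ (λs , l , ℕ.+-cancelˡ-≡ (suc k) _ _ eq)

  from : Ascending (suc k) (suc k + t) → _
  from (_ ∷ _ , k≤a ∷ l , eq) = branch-on (ℕ.m≤n⇒m<n∨m≡n k≤a) l eq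

  to-branch-on : ∀ {a λs} d l eq → proj₁ (to (branch-on {a} {λs} d l eq)) ≡ a ∷ λs
  to-branch-on (inj₁ _)    _ _ = refl
  to-branch-on (inj₂ refl) _ _ = refl

  to-from : ∀ p → to (from p) ≡ p
  to-from (_ ∷ _ , k≤a ∷ l , eq) = Ascending-≡ (to-branch-on (ℕ.m≤n⇒m<n∨m≡n k≤a) l eq)

  branch-on-< : ∀ {a λs} d k<a l eq → branch-on {a} {λs} d l eq ≡ inj₁ (a ∷ λs , k<a ∷ l , eq)
  branch-on-< (inj₁ _)    _   _ _ = cong inj₁ (Ascending-≡ refl)
  branch-on-< (inj₂ refl) k<a _ _ = contradiction k<a (ℕ.<-irrefl refl)

  branch-on-≡ : ∀ {λs} d l eq eq′ → branch-on {suc k} {λs} d l eq ≡ inj₂ (λs , l , eq′)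
  branch-on-≡ (inj₁ k<k)  _ _ _ = contradiction k<k (ℕ.<-irrefl refl)
  branch-on-≡ (inj₂ refl) _ _ _ = cong inj₂ (Ascending-≡ refl)

  from-to : ∀ p → from (to p) ≡ p
  from-to (inj₁ (_ ∷ _ , k<a ∷ l , eq)) = branch-on-< (ℕ.m≤n⇒m<n∨m≡n _) k<a l eq
  from-to (inj₂ (_ , l , eq))           = branch-on-≡ (ℕ.m≤n⇒m<n∨m≡n ℕ.≤-refl) l _ eq

empty-size : ∀ {A : Set} → ¬ A → HasSize A 0
empty-size ¬A = mk↔ₛ′ (λ ()) (λ a → contradiction a ¬A) (λ a → contradiction a ¬A) (λ ())

-- The first entry of the list is the final size of the current part, which is at
-- least suc k.  In continue-size all but c of its first suc k letters have been
-- read, so that this part and the later ones have sum s; if m < c, then s is less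
-- than suc k and there are no such lists.
mutual
  choose-size : ∀ k m → HasSize (Ascending (suc k) (suc k + m)) (choose k (1^ m))
  choose-size k zero =
    ↔-trans +↔⊎ (↔-trans
      (empty-size (Ascending-empty (s≤s z≤n) (s≤s (s≤s (ℕ.≤-reflexive (ℕ.+-identityʳ k)))))
        ⊎-↔ Ascending-zero k)
      (Ascending-split k 0))
  choose-size k (suc m) =
    ↔-trans +↔⊎ (↔-trans
      (subst (λ s → HasSize (Ascending (2 + k) s) (choose (suc k) (1^ m)))
             (cong suc (sym (ℕ.+-suc k m))) (choose-size (suc k) m)
        ⊎-↔ continue-size k k m (suc m) ℕ.≤-refl (cong suc (ℕ.+-comm m k)))
      (Ascending-split k (suc m)))

  continue-size : ∀ k c m s → c ≤ k → s + c ≡ suc k + m →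
                  HasSize (Ascending (suc k) s) (continue k c (1^ m))
  continue-size k zero m s _ eq =
    subst (λ s → HasSize (Ascending (suc k) s) _) (trans (sym eq) (ℕ.+-identityʳ s)) (choose-size k m)
  continue-size k (suc c) zero s c<k eq = empty-size (Ascending-empty 0<s s<k)
    where
    eq′ : s + suc c ≡ suc k
    eq′ = trans eq (ℕ.+-identityʳ (suc k))

    0<s : 0 < s
    0<s = ℕ.+-cancelʳ-< (suc c) 0 s (subst (suc c <_) (sym eq′) (s≤s c<k))

    s<k : s < suc k
    s<k = subst (s <_) eq′ (ℕ.m<m+n s (s≤s z≤n))
  continue-size k (suc c) (suc m) s c<k eq =
    continue-size k c m s (ℕ.<⇒≤ c<k)
      (ℕ.suc-injective (trans (sym (ℕ.+-suc s c)) (trans eq (cong suc (ℕ.+-suc k m)))))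

Ascending-size : ∀ n → HasSize (Ascending 1 n) (paths (1^ n))
Ascending-size zero    = Ascending-zero 0
Ascending-size (suc n) = choose-size 0 n

module _ {R : ℕ → ℕ → Set} where
  linked-ʳ++ : ∀ {a as bs} → Linked R (a ∷ as) → Linked (flip R) (a ∷ bs) →
               Linked (flip R) (as ʳ++ a ∷ bs)
  linked-ʳ++ [-]      l = l
  linked-ʳ++ (r ∷ l′) l = linked-ʳ++ l′ (r ∷ l)

  linked-reverse : ∀ {as} → Linked R as → Linked (flip R) (reverse as)
  linked-reverse []        = []
  linked-reverse [-]       = [-]
  linked-reverse l@(_ ∷ _) = linked-ʳ++ l [-]

-- Partitions list their parts in decreasing order, so the bijection is reversal.
Ascending↔Par : ∀ n → Ascending 1 n ↔ Par n
Ascending↔Par n = mk↔ₛ′ to from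
  (λ _ → Par-≡′ (List.reverse-involutive _)) (λ _ → Ascending-≡ (List.reverse-involutive _))
  where
  Par-≡′ : {p q : Par n} → proj₁ p ≡ proj₁ q → p ≡ q
  Par-≡′ {λs , a , l , eq} {_ , a′ , l′ , eq′} refl =
    cong (λs ,_) (cong₂ _,_ (All.irrelevant ℕ.≤-irrelevant a a′)
      (cong₂ _,_ (Linked.irrelevant ℕ.≤-irrelevant l l′) (ℕ.≡-irrelevant eq eq′)))

  sum-reverse : ∀ λs → sum (reverse λs) ≡ sum λs
  sum-reverse λs = sum-↭ (↭-reverse λs)

  cons-one : ∀ {λs} → All (0 <_) λs → Linked _≤_ λs → Linked _≤_ (1 ∷ λs)
  cons-one []      _ = [-]
  cons-one (p ∷ _) l = p ∷ l

  to : Ascending 1 n → Par n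
  to (λs , l , eq) =
    reverse λs
    , All-resp-↭ (↭-sym (↭-reverse λs)) (All.tail (Linked⇒All ℕ.≤-trans (ℕ.≤-refl {1}) l))
    , linked-reverse (Linked.tail l)
    , trans (sum-reverse λs) eq

  from : Par n → Ascending 1 n
  from (λs , a , l , eq) =
    reverse λs
    , cons-one (All-resp-↭ (↭-sym (↭-reverse λs)) a) (linked-reverse l)
    , trans (sum-reverse λs) eq

paths-unary : ∀ n → paths (1^ n) ≡ #Par n
paths-unary n =
  ↔⇒≡ (↔-trans (↔-trans (Ascending-size n) (Ascending↔Par n)) (↔-sym (proj₂ (Par-finite n))))

mutual
  choose-nonunary : ∀ k y → y ≢ 1^ length y → choose k y ≡ 0
  choose-nonunary k []          ≢1 = contradiction refl ≢1
  choose-nonunary k (false ∷ y) ≢1 = refl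
  choose-nonunary k (true ∷ y)  ≢1 =
    cong₂ _+_ (choose-nonunary (suc k) y (≢1 ∘ cong (true ∷_)))
              (continue-nonunary k k y (≢1 ∘ cong (true ∷_)))

  continue-nonunary : ∀ k c y → y ≢ 1^ length y → continue k c y ≡ 0
  continue-nonunary k zero    y           ≢1 = choose-nonunary k y ≢1
  continue-nonunary k (suc c) []          ≢1 = refl
  continue-nonunary k (suc c) (false ∷ y) ≢1 = refl
  continue-nonunary k (suc c) (true ∷ y)  ≢1 = continue-nonunary k c y (≢1 ∘ cong (true ∷_))

paths-nonunary : ∀ x → x ≢ 1^ length x → paths x ≡ 0
paths-nonunary []          ≢1 = contradiction refl ≢1
paths-nonunary (false ∷ _) ≢1 = refl
paths-nonunary (true ∷ y)  ≢1 = choose-nonunary 0 y (≢1 ∘ cong (true ∷_))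

paths-onUnary : ∀ x → paths x ≡ onUnary #Par x
paths-onUnary x with x ≟ˢ (1^ length x)
... | yes eq = trans (cong paths eq) (paths-unary (length x))
... | no ≢1  = paths-nonunary x ≢1

theorem5p1 : #L (onUnary #Par)
theorem5p1 = machine
  , (3 , λ x → ComputationTree.space-bound machine x _ (tree x))
  , (λ x → ComputationTree.halts machine x _ (tree x))
  , (λ x → subst (HasSize _) (paths-onUnary x) (ComputationTree.count machine x _ (tree x)))
  where
  -- Besides the digits, one blank on each side is visited.
  fits : ∀ n k → k ≤ n → 2 + length (bits k) ≤ 3 * (1 + ⌊log₂ n ⌋)
  fits n k k≤n = begin
    2 + length (bits k)      ≤⟨ ℕ.+-monoʳ-≤ 2 (length-bits k≤n) ⟩
    3 + ⌊log₂ n ⌋            ≤⟨ ℕ.+-monoʳ-≤ 3 (ℕ.m≤n*m ⌊log₂ n ⌋ 3) ⟩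
    3 + 3 * ⌊log₂ n ⌋        ≡⟨ ℕ.*-distribˡ-+ 3 1 ⌊log₂ n ⌋ ⟨
    3 * (1 + ⌊log₂ n ⌋)      ∎
    where open ℕ.≤-Reasoning

  tree : ∀ x → ComputationTree.Tree machine x (3 * (1 + ⌊log₂ length x ⌋))
                 (NTM.initial machine) (paths x)
  tree x = start-tree x _ (fits (length x))
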